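{- Let $n\ge 5$ be even and let $x,y$ be adjacent vertices of $Q_n$ with $f_n(x)+f_n(y)=\operatorname{str}_{f_n}(Q_n)$. If $x$ and $y$ both begin with $10$, then $$\operatorname{str}_{f_n}(Q_n)\le \operatorname{str}_{f_{n-2}}(Q_{n-2})+3\cdot 2^{n-2}+\binom{n-3}{\lceil (n-3)/2\rceil}+\binom{n-2}{\lceil (n-2)/2\rceil}.$$
   Context: $Q_n$ is the $n$-dimensional hypercube: vertices are the $n$-bit strings, adjacent iff they differ in exactly one position. For a bijection $f:V(G)\to\{1,\dots,|V(G)|\}$, $\operatorname{str}_f(G)=\max\{f(u)+f(v):uv\in E(G)\}$. An $n$-bit string is $x_1\cdots x_n$, $x_i\in\{0,1\}$; its weight is its number of $1$s. Lexicographic order: $x<y$ if for some $k$, $x_j=y_j$ for $j<k$ and $x_k<y_k$. $S_n^i$ is the sequence of $n$-bit strings of weight $i$ in increasing lexicographic order; $R_n^i$ is the same set in decreasing lexicographic order. $S_n$ is the concatenation $(R_n^1,R_n^3,\dots,R_n^{n-1},S_n^n,S_n^{n-2},\dots,S_n^2,S_n^0)$ for even $n$ and $(R_n^1,R_n^3,\dots,R_n^{n-2},R_n^n,S_n^{n-1},\dots,S_n^2,S_n^0)$ for odd $n$; $f_n$ maps the string in position $j$ of $S_n$ to $j$. -}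

module Defs where

open import Data.Bool.Base using (Bool; true; false; f<t) renaming (_<_ to _<ᵇ_)
import Data.Bool.Properties as Bool
open import Data.Empty using (⊥-elim)
open import Data.Fin.Base as Fin using (Fin; toℕ; fromℕ<)
import Data.Fin.Properties as Fin
open import Data.List.Base using (List; []; _∷_; _++_; map; filter; reverse; concatMap; upTo; downFrom; cartesianProduct; length; lookup)
open import Data.List.Extrema.Nat using (max; xs≤max; argmax-sel)
open import Data.List.Membership.Propositional using (_∈_; find; lose)
open import Data.List.Membership.Propositional.Properties using (∈-++⁺ˡ; ∈-++⁺ʳ; ∈-map⁺; ∈-map⁻; ∈-filter⁺; ∈-filter⁻; ∈-concatMap⁺; ∈-concatMap⁻; ∈-upTo⁺; ∈-downFrom⁺; ∈-cartesianProduct⁺; ∈-lookup)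
open import Data.List.Membership.Propositional.Properties.WithK using (unique⇒irrelevant; unique∧set⇒bag)
open import Data.List.Properties using (length-map; length-++; unfold-reverse)
open import Data.List.Relation.Binary.BagAndSetEquality using (∼bag⇒↭)
open import Data.List.Relation.Binary.Disjoint.Propositional using (Disjoint)
open import Data.List.Relation.Binary.Permutation.Propositional using (↭-sym)
open import Data.List.Relation.Binary.Permutation.Propositional.Properties using (∈-resp-↭; All-resp-↭; ↭-length; ↭-reverse)
open import Data.List.Relation.Unary.All as All using (All; []; _∷_)
import Data.List.Relation.Unary.All.Properties as All
open import Data.List.Relation.Unary.AllPairs as AllPairs using (AllPairs; []; _∷_)
import Data.List.Relation.Unary.AllPairs.Properties as AllPairs
open import Data.List.Relation.Unary.Any using (here; index)
open import Data.List.Relation.Unary.Any.Properties using (lookup-index)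
open import Data.List.Relation.Unary.Unique.Propositional using (Unique)
import Data.List.Relation.Unary.Unique.Propositional.Properties as Unique
open import Data.Nat.Base using (ℕ; zero; suc; _+_; _^_; _≤_; _<_; s≤s; z≤n)
open import Data.Nat.Divisibility using (_∣_; _∣?_)
import Data.Nat.Properties as ℕ
open import Data.Product using (∃; ∃!; _×_; _,_; proj₁; proj₂; uncurry)
open import Data.Sum.Base using (inj₁; inj₂)
open import Data.Vec.Base as Vec using (Vec; []; _∷_; count)
import Data.Vec.Properties as Vec
open import Data.Vec.Relation.Binary.Lex.Strict using (Lex-<; this; next)
open import Data.Vec.Relation.Binary.Pointwise.Inductive using (≡⇒Pointwise-≡)
import Data.Vec.Relation.Binary.Lex.Strict as Lex
open import Function.Base using (id; flip)
open import Function.Bundles using (mk⇔)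
open import Relation.Binary.PropositionalEquality using (_≡_; _≢_; refl; sym; trans; cong; cong₂; subst)
open import Relation.Nullary using (Dec; yes; no; ¬_; ¬?)
open import Relation.Nullary.Decidable using (map′; _×-dec_; _→-dec_)

Bits : ℕ → Set
Bits = Vec Bool

Adjacent : ∀ {n} → Bits n → Bits n → Set
Adjacent x y = ∃! _≡_ (λ i → Vec.lookup x i ≢ Vec.lookup y i)

adjacent? : ∀ {n} (x y : Bits n) → Dec (Adjacent x y)
adjacent? x y = Fin.any? λ i → differ? i ×-dec
  map′ (λ h {j} → h j) (λ h j → h) (Fin.all? λ j → differ? j →-dec i Fin.≟ j)
  where
  differ? : ∀ i → Dec (Vec.lookup x i ≢ Vec.lookup y i)
  differ? i = ¬? (Vec.lookup x i Bool.≟ Vec.lookup y i)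

weight : ∀ {n} → Bits n → ℕ
weight = count (Bool._≟ true)

infix 4 _<ₗₑₓ_

_<ₗₑₓ_ : ∀ {n} → Bits n → Bits n → Set
_<ₗₑₓ_ = Lex-< _≡_ _<ᵇ_

-- All n-bit strings, in increasing lexicographic order (see allBits-increasing).
allBits : ∀ n → List (Bits n)
allBits zero    = [] ∷ []
allBits (suc n) = map (false ∷_) (allBits n) ++ map (true ∷_) (allBits n)

S : ∀ n → ℕ → List (Bits n)
S n i = filter (λ x → weight x ℕ.≟ i) (allBits n)

R : ∀ n → ℕ → List (Bits n)
R n i = reverse (S n i)

oddsUpTo : ℕ → List ℕ
oddsUpTo n = filter (λ i → ¬? (2 ∣? i)) (upTo (suc n))

evensDownFrom : ℕ → List ℕ
evensDownFrom n = filter (2 ∣?_) (downFrom (suc n))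

-- The sequence S_n, for both parities of n: the blocks R_n^i for odd i ≤ n in
-- increasing order of i, then the blocks S_n^i for even i ≤ n in decreasing order.
seq : ∀ n → List (Bits n)
seq n = concatMap (R n) (oddsUpTo n) ++ concatMap (S n) (evensDownFrom n)

∈-allBits : ∀ {n} (x : Bits n) → x ∈ allBits n
∈-allBits []          = here refl
∈-allBits (false ∷ x) = ∈-++⁺ˡ (∈-map⁺ (false ∷_) (∈-allBits x))
∈-allBits (true  ∷ x) = ∈-++⁺ʳ (map (false ∷_) (allBits _)) (∈-map⁺ (true ∷_) (∈-allBits x))

∈-S : ∀ {n} (x : Bits n) → x ∈ S n (weight x)
∈-S x = ∈-filter⁺ _ (∈-allBits x) refl

∈-R : ∀ {n} (x : Bits n) → x ∈ R n (weight x)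
∈-R x = ∈-resp-↭ (↭-sym (↭-reverse _)) (∈-S x)

∈-seq : ∀ {n} (x : Bits n) → x ∈ seq n
∈-seq {n} x with 2 ∣? weight x
... | no odd   = ∈-++⁺ˡ (∈-concatMap⁺ (R n)
  (lose (∈-filter⁺ (λ i → ¬? (2 ∣? i)) (∈-upTo⁺ (s≤s (Vec.count≤n (Bool._≟ true) x))) odd) (∈-R x)))
... | yes even = ∈-++⁺ʳ (concatMap (R n) (oddsUpTo n)) (∈-concatMap⁺ (S n)
  (lose (∈-filter⁺ (2 ∣?_) (∈-downFrom⁺ (s≤s (Vec.count≤n (Bool._≟ true) x))) even) (∈-S x)))

-- Positions are counted from 1, whereas index counts from 0.  Each string occurs
-- exactly once in seq n (seq-unique), so the position does not depend on the
-- membership proof.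
f : ∀ n → Bits n → ℕ
f n x = suc (toℕ (index (∈-seq x)))

-- Each edge is listed once in each direction.
edges : ∀ n → List (Bits n × Bits n)
edges n = filter (uncurry adjacent?) (cartesianProduct (allBits n) (allBits n))

-- The default value 0 of the maximum is only attained when n = 0, where there are
-- no edges, or when g vanishes at the ends of every edge.
str : ∀ n → (Bits n → ℕ) → ℕ
str n g = max 0 (map (λ (u , v) → g u + g v) (edges n))

str-upper : ∀ {n} (g : Bits n → ℕ) {u v} → Adjacent u v → g u + g v ≤ str n g
str-upper {n} g uv = All.lookup (xs≤max 0 (map (λ (u , v) → g u + g v) (edges n)))
  (∈-map⁺ (λ (u , v) → g u + g v)
    (∈-filter⁺ (uncurry adjacent?) (∈-cartesianProduct⁺ (∈-allBits _) (∈-allBits _)) uv))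

zeros-edge : ∀ n → ∃ λ (u : Bits (suc n)) → ∃ (Adjacent u)
zeros-edge n = false ∷ z , true ∷ z , Fin.zero , (λ ()) ,
  λ { {Fin.zero} _ → refl ; {Fin.suc j} ne → ⊥-elim (ne refl) }
  where
  z : Bits n
  z = Vec.replicate n false

str-attained : ∀ n (g : Bits (suc n) → ℕ) →
               ∃ λ u → ∃ λ v → Adjacent u v × g u + g v ≡ str (suc n) g
str-attained n g with argmax-sel id 0 (map (λ (u , v) → g u + g v) (edges (suc n)))
... | inj₂ m∈ with (u , v) , e∈ , eq ← ∈-map⁻ (λ (u , v) → g u + g v) m∈ =
  u , v , proj₂ (∈-filter⁻ (uncurry adjacent?) {xs = cartesianProduct (allBits (suc n)) (allBits (suc n))} e∈) , sym eq
... | inj₁ m≡0 with u , v , uv ← zeros-edge n =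
  u , v , uv , trans (ℕ.n≤0⇒n≡0 (subst (g u + g v ≤_) m≡0 (str-upper g uv))) (sym m≡0)

allBits-increasing : ∀ n → AllPairs _<ₗₑₓ_ (allBits n)
allBits-increasing zero    = [] ∷ []
allBits-increasing (suc n) = AllPairs.++⁺
  (AllPairs.map⁺ (AllPairs.map (next refl) (allBits-increasing n)))
  (AllPairs.map⁺ (AllPairs.map (next refl) (allBits-increasing n)))
  (All.map⁺ (All.universal (λ _ → All.map⁺ (All.universal (λ _ → this f<t refl) _)) _))

S-increasing : ∀ n i → AllPairs _<ₗₑₓ_ (S n i)
S-increasing n i = AllPairs.filter⁺ _ (allBits-increasing n)

reverse-AllPairs : ∀ {A : Set} {_~_ : A → A → Set} {xs} →
                   AllPairs _~_ xs → AllPairs (flip _~_) (reverse xs)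
reverse-AllPairs []                  = []
reverse-AllPairs {_~_ = _~_} {xs = x ∷ xs} (p ∷ ps) =
  subst (AllPairs (flip _~_)) (sym (unfold-reverse x xs))
    (AllPairs.++⁺ (reverse-AllPairs ps) ([] ∷ [])
      (All.map (_∷ []) (All-resp-↭ (↭-sym (↭-reverse xs)) p)))

R-decreasing : ∀ n i → AllPairs (flip _<ₗₑₓ_) (R n i)
R-decreasing n i = reverse-AllPairs (S-increasing n i)

<ₗₑₓ⇒≢ : ∀ {n} {x y : Bits n} → x <ₗₑₓ y → x ≢ y
<ₗₑₓ⇒≢ p eq = Lex.<-irrefl Bool.<-irrefl (≡⇒Pointwise-≡ eq) p

weight-S : ∀ {n i} {x : Bits n} → x ∈ S n i → weight x ≡ i
weight-S {n} {i} x∈ = proj₂ (∈-filter⁻ (λ x → weight x ℕ.≟ i) {xs = allBits n} x∈)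

weight-R : ∀ {n i} {x : Bits n} → x ∈ R n i → weight x ≡ i
weight-R x∈ = weight-S (∈-resp-↭ (↭-reverse _) x∈)

seq-unique : ∀ n → Unique (seq n)
seq-unique n = Unique.++⁺
  (blocks weight-R (λ i → AllPairs.map (λ p eq → <ₗₑₓ⇒≢ p (sym eq)) (R-decreasing n i))
    (Unique.filter⁺ (λ i → ¬? (2 ∣? i)) (Unique.upTo⁺ (suc n))))
  (blocks weight-S (λ i → AllPairs.map <ₗₑₓ⇒≢ (S-increasing n i))
    (Unique.filter⁺ (2 ∣?_) (Unique.downFrom⁺ (suc n))))
  (λ { (x∈R , x∈S) → odd x∈R (even x∈S) })
  where
  blocks : ∀ {B : ℕ → List (Bits n)} → (∀ {i x} → x ∈ B i → weight x ≡ i) →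
           (∀ i → Unique (B i)) → ∀ {is} → Unique is → Unique (concatMap B is)
  blocks {B} w u is! = Unique.concat⁺ (All.map⁺ (All.universal u _))
    (AllPairs.map⁺ (AllPairs.map disjoint is!))
    where
    disjoint : ∀ {i j} → i ≢ j → Disjoint (B i) (B j)
    disjoint i≢j (p , q) = i≢j (trans (sym (w p)) (w q))

  odd : ∀ {x} → x ∈ concatMap (R n) (oddsUpTo n) → ¬ (2 ∣ weight x)
  odd x∈ with i , i∈ , x∈R ← find (∈-concatMap⁻ (R n) {xs = oddsUpTo n} x∈) =
    subst (λ k → ¬ (2 ∣ k)) (sym (weight-R x∈R))
      (proj₂ (∈-filter⁻ (λ i → ¬? (2 ∣? i)) {xs = upTo (suc n)} i∈))

  even : ∀ {x} → x ∈ concatMap (S n) (evensDownFrom n) → 2 ∣ weight x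
  even x∈ with i , i∈ , x∈S ← find (∈-concatMap⁻ (S n) {xs = evensDownFrom n} x∈) =
    subst (2 ∣_) (sym (weight-S x∈S))
      (proj₂ (∈-filter⁻ (2 ∣?_) {xs = downFrom (suc n)} i∈))

length-allBits : ∀ n → length (allBits n) ≡ 2 ^ n
length-allBits zero    = refl
length-allBits (suc n) = trans (length-++ (map (false ∷_) (allBits n)))
  (cong₂ _+_ (trans (length-map _ (allBits n)) (length-allBits n))
             (trans (trans (length-map _ (allBits n)) (length-allBits n))
                    (sym (ℕ.+-identityʳ (2 ^ n)))))

length-seq : ∀ n → length (seq n) ≡ 2 ^ n
length-seq n = trans (↭-length (∼bag⇒↭ (unique∧set⇒bag (seq-unique n)
  (AllPairs.map <ₗₑₓ⇒≢ (allBits-increasing n))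
  (mk⇔ (λ _ → ∈-allBits _) (λ _ → ∈-seq _))))) (length-allBits n)

-- f n is a bijection onto {1, …, 2 ^ n}.

f-range : ∀ n x → 1 ≤ f n x × f n x ≤ 2 ^ n
f-range n x = s≤s z≤n , subst (f n x ≤_) (length-seq n) (Fin.toℕ<n (index (∈-seq x)))

f-injective : ∀ n {x y} → f n x ≡ f n y → x ≡ y
f-injective n {x} {y} eq = trans (lookup-index (∈-seq x))
  (trans (cong (lookup (seq n)) (Fin.toℕ-injective (ℕ.suc-injective eq)))
         (sym (lookup-index (∈-seq y))))

f-surjective : ∀ n {k} → 1 ≤ k → k ≤ 2 ^ n → ∃ λ x → f n x ≡ k
f-surjective n {suc k} _ k<2^n = lookup (seq n) i , cong suc
  (trans (cong toℕ (trans (cong index (unique⇒irrelevant (seq-unique n) (∈-seq _) (∈-lookup i)))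
                          (index-∈-lookup (seq n) i)))
         (Fin.toℕ-fromℕ< k<len))
  where
  k<len : k < length (seq n)
  k<len = subst (k <_) (sym (length-seq n)) k<2^n

  i : Fin (length (seq n))
  i = fromℕ< k<len

  index-∈-lookup : ∀ {A : Set} (xs : List A) j → index (∈-lookup {xs = xs} j) ≡ j
  index-∈-lookup (x ∷ xs) Fin.zero    = refl
  index-∈-lookup (x ∷ xs) (Fin.suc j) = cong Fin.suc (index-∈-lookup xs j)

{-# OPTIONS --safe #-}

-- Write Φ x for one plus the number of strings that have the parity of x in weight
-- and are either lighter than x or lexicographically larger of the same weight.
-- Then f x = Φ x for odd weight and f x = 2 ^ n + 1 − Φ x for even weight.
-- Complementing strings reverses the order counted by Φ, so Φ x + Φ (¬ x) =
-- 2 ^ (n − 1) + 1; prefixing 10 adds to Φ a sum of binomial coefficients that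
-- depends on the weight only.  With m = n − 2 even, complementation in Q_m keeps
-- the parity of weights, and therefore f (10u) + f (10v) exceeds
-- f (¬ u) + f (¬ v), a sum over an edge of Q_m, by 3 · 2 ^ m plus at most
-- C(m , k) + C(m − 1 , k), where k is the odd one of the weights of u and v.

module Submission where

open import Data.Bool.Base using (true; false; not)
import Data.Bool.Properties as Bool
open import Data.Fin.Base as Fin using (toℕ)
import Data.Fin.Properties as Fin
open import Data.List.Base using (List; []; _∷_; _++_; _∷ʳ_; [_]; map; filter; reverse; concatMap; upTo; downFrom; length)
open import Data.List.Membership.Propositional using (_∈_)
open import Data.List.Membership.Propositional.Properties using (∈-++⁺ʳ)
open import Data.List.Properties using (length-map; length-++; length-reverse; map-++; ++-assoc; ++-identityʳ; reverse-++; unfold-reverse; concatMap-++; filter-++; filter-accept; filter-reject; filter-≐; filter-none; upTo-∷ʳ)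
open import Data.List.Relation.Binary.Prefix.Heterogeneous using (Prefix; _∷_)
import Data.List.Relation.Unary.All as All
open import Data.List.Relation.Unary.AllPairs using (_∷_)
open import Data.List.Relation.Unary.Any using (here; there; index)
open import Data.List.Relation.Unary.Unique.Propositional using (Unique)
open import Data.Nat.Base using (ℕ; zero; suc; pred; _+_; _*_; _∸_; _^_; _≤_; _≥_; z≤n; s≤s; ⌊_/2⌋; ⌈_/2⌉)
open import Data.Nat.Combinatorics using (_C_; nCk≡nC[n∸k]; nCk+nC[k+1]≡[n+1]C[k+1]; k>n⇒nCk≡0)
open import Data.Nat.Divisibility using (_∣_; _∣?_; divides; ∣m+n∣m⇒∣n; n∣m*n; ∣1⇒≡1)
open import Data.Nat.Properties
open import Data.Nat.Tactic.RingSolver using (solve-∀)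
open import Data.Product using (∃; _×_; _,_)
open import Data.Sum.Base using (_⊎_; inj₁; inj₂)
import Data.Sum.Base as Sum
open import Data.Vec.Base as Vec using ([]; _∷_; toList)
import Data.Vec.Properties as Vec
open import Function.Base using (_∘_)
open import Relation.Binary.PropositionalEquality using (_≡_; refl; sym; trans; cong; cong₂; subst; module ≡-Reasoning)
open import Relation.Nullary using (decidable-stable; yes; no; ¬_; ¬?; contradiction)
open import Relation.Unary using (Decidable)
open import Defs

-- Binomial coefficients

pascal : ∀ n k → suc n C suc k ≡ n C k + n C suc k
pascal n k = sym (nCk+nC[k+1]≡[n+1]C[k+1] n k)

-- The hypotheses place `b` between `a` and its mirror image `m - a`, where row `m` does not fall
-- below its entry at `a`. In the induction the Pascal summands are compared crosswise, outer with
-- outer and inner with inner: `m C a` with `m C suc b`, and `m C suc a` with `m C b`. Both pairs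
-- satisfy the hypotheses again when `a < b`.
C-mono : ∀ m {a b} → a ≤ b → a + b ≤ m → m C a ≤ m C b
C-mono m {b = zero} z≤n _ = ≤-refl
C-mono (suc m) {b = suc b} z≤n (s≤s b≤m) = begin
  1                 ≤⟨ C-mono m {b = b} z≤n b≤m ⟩
  m C b             ≤⟨ m≤m+n (m C b) _ ⟩
  m C b + m C suc b ≡⟨ pascal m b ⟨
  suc m C suc b     ∎
  where open ≤-Reasoning
C-mono (suc m) {suc a} {suc b} (s≤s a≤b) (s≤s a+1+b≤m) with m≤n⇒m<n∨m≡n a≤b
... | inj₂ refl = ≤-refl
... | inj₁ a<b = begin
  suc m C suc a     ≡⟨ pascal m a ⟩
  m C a + m C suc a ≤⟨ +-mono-≤ (C-mono m (m≤n⇒m≤1+n a≤b) a+1+b≤m)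
                                (C-mono m a<b (subst (_≤ m) (+-suc a b) a+1+b≤m)) ⟩
  m C suc b + m C b ≡⟨ +-comm (m C suc b) (m C b) ⟩
  m C b + m C suc b ≡⟨ pascal m b ⟨
  suc m C suc b     ∎
  where open ≤-Reasoning

C≤central-lower : ∀ m {k} → k ≤ ⌊ m /2⌋ → m C k ≤ m C ⌈ m /2⌉
C≤central-lower m {k} k≤h = C-mono m (≤-trans k≤h (⌊n/2⌋≤⌈n/2⌉ m))
  (subst (k + ⌈ m /2⌉ ≤_) (⌊n/2⌋+⌈n/2⌉≡n m) (+-monoˡ-≤ ⌈ m /2⌉ k≤h))

C≤central : ∀ m k → m C k ≤ m C ⌈ m /2⌉
C≤central m k with k ≤? ⌊ m /2⌋ | k ≤? m
... | yes k≤h | _       = C≤central-lower m k≤h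
... | no _    | no k≰m  = subst (_≤ m C ⌈ m /2⌉) (sym (k>n⇒nCk≡0 (≰⇒> k≰m))) z≤n
... | no k≰h  | yes k≤m = subst (_≤ m C ⌈ m /2⌉) (sym (nCk≡nC[n∸k] k≤m))
  (C≤central-lower m (m≤n+o⇒m∸n≤o m k (begin
    m                   ≡⟨ ⌊n/2⌋+⌈n/2⌉≡n m ⟨
    -- `⌈ m /2⌉` is `⌊ suc m /2⌋`, hence at most `suc ⌊ m /2⌋`, and this is at most `k`. So the
    -- mirror image `m ∸ k` lies in the lower half.
    ⌊ m /2⌋ + ⌈ m /2⌉   ≤⟨ +-monoʳ-≤ ⌊ m /2⌋ (≤-trans (⌊n/2⌋-mono (n≤1+n (suc m))) (≰⇒> k≰h)) ⟩
    ⌊ m /2⌋ + k         ≡⟨ +-comm ⌊ m /2⌋ k ⟩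
    k + ⌊ m /2⌋         ∎)))
  where open ≤-Reasoning

-- Shifted binomial coefficients and partial sums of rows

-- The binomial coefficient at `k - 1`, with value 0 at `k = 0` (where `n C pred k` would be 1), so
-- that Pascal's rule holds at every index.
C⁻ : ℕ → ℕ → ℕ
C⁻ n zero    = 0
C⁻ n (suc k) = n C k

pascal⁻ : ∀ n k → suc n C k ≡ C⁻ n k + n C k
pascal⁻ n zero    = refl
pascal⁻ n (suc k) = pascal n k

C⁻-sym : ∀ {n} a k → a + k ≡ n → C⁻ n a ≡ n C suc k
C⁻-sym zero    k refl = sym (k>n⇒nCk≡0 (n<1+n k))
C⁻-sym (suc a) k refl = trans (nCk≡nC[n∸k] {k = a} (m≤n⇒m≤1+n (m≤m+n a k)))
  (cong (suc (a + k) C_) (trans (cong (_∸ a) (sym (+-suc a k))) (m+n∸m≡n a (suc k))))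

-- The number of `n`-bit strings of weight less than `w`.
B : ℕ → ℕ → ℕ
B n zero    = 0
B n (suc w) = B n w + n C w

B-mono : ∀ n {v w} → v ≤ w → B n v ≤ B n w
B-mono n {w = zero}  z≤n = z≤n
B-mono n {w = suc w} v≤w with m≤n⇒m<n∨m≡n v≤w
... | inj₁ (s≤s v≤w′) = ≤-trans (B-mono n v≤w′) (m≤m+n (B n w) (n C w))
... | inj₂ refl       = ≤-refl

B-pred : ∀ n w → B n (pred w) + C⁻ n w ≡ B n w
B-pred n zero    = refl
B-pred n (suc w) = refl

interchange : ∀ a b c d → a + b + (c + d) ≡ a + c + (b + d)
interchange = solve-∀

B-pascal : ∀ n w → B (suc n) (suc w) ≡ B n (suc w) + B n w
B-pascal n zero    = refl
B-pascal n (suc w) = begin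
  B (suc n) (suc w) + suc n C suc w             ≡⟨ cong₂ _+_ (B-pascal n w) (trans (pascal n w) (+-comm (n C w) _)) ⟩
  B n (suc w) + B n w + (n C suc w + n C w)     ≡⟨ interchange (B n (suc w)) (B n w) (n C suc w) (n C w) ⟩
  B n (suc w) + n C suc w + (B n w + n C w)     ∎
  where open ≡-Reasoning

B-pascal⁻ : ∀ n w → B (suc n) w ≡ B n w + B n (pred w)
B-pascal⁻ n zero    = refl
B-pascal⁻ n (suc w) = B-pascal n w

B-full : ∀ n → B n (suc n) ≡ 2 ^ n
B-full zero    = refl
B-full (suc n) = begin
  B (suc n) (suc (suc n))              ≡⟨ B-pascal n (suc n) ⟩
  B n (suc n) + n C suc n + B n (suc n) ≡⟨ cong₂ (λ c b → b + c + b) (k>n⇒nCk≡0 (n<1+n n)) (B-full n) ⟩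
  2 ^ n + 0 + 2 ^ n                    ≡⟨ +-assoc (2 ^ n) 0 (2 ^ n) ⟩
  2 ^ n + (0 + 2 ^ n)                  ≡⟨ cong (2 ^ n +_) (+-comm 0 (2 ^ n)) ⟩
  2 ^ suc n                            ∎
  where open ≡-Reasoning

-- Reflecting row `n` sends the entries below `b` to the entries from `a` on, so the two sums make
-- up the whole row. The induction regroups the Pascal summands into the pairs (`suc a`, `b`) and
-- (`a`, `suc b`) of the previous row.
B-sym : ∀ n a b → a + b ≡ suc n → B n a + B n b ≡ 2 ^ n
B-sym n zero b refl = B-full n
B-sym n (suc a) zero eq with refl ← trans (sym (+-identityʳ (suc a))) eq =
  trans (+-identityʳ _) (B-full n)
B-sym zero    (suc a) (suc b) eq with () ← trans (sym (+-suc a b)) (suc-injective eq)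
B-sym (suc n) (suc a) (suc b) eq = begin
  B (suc n) (suc a) + B (suc n) (suc b)           ≡⟨ cong₂ _+_ (B-pascal n a) (trans (B-pascal n b) (+-comm (B n (suc b)) _)) ⟩
  B n (suc a) + B n a + (B n b + B n (suc b))     ≡⟨ interchange (B n (suc a)) (B n a) (B n b) (B n (suc b)) ⟩
  B n (suc a) + B n b + (B n a + B n (suc b))     ≡⟨ cong₂ _+_ (B-sym n (suc a) b a+1+b) (B-sym n a (suc b) (trans (+-suc a b) a+1+b)) ⟩
  2 ^ n + 2 ^ n                                   ≡⟨ cong (2 ^ n +_) (+-identityʳ (2 ^ n)) ⟨
  2 ^ suc n                                       ∎
  where
  open ≡-Reasoning
  a+1+b : suc a + b ≡ suc n
  a+1+b = trans (sym (+-suc a b)) (suc-injective eq)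

-- Ranks of strings

-- The number of strings of the weight of x that are lexicographically larger than x.
G : ∀ {n} → Bits n → ℕ
G []                  = 0
G (true ∷ x)          = G x
G {suc n} (false ∷ x) = G x + C⁻ n (weight x)

-- By Pascal's rule, the sizes `suc n C j` for `j = w - 2, w - 4, …` split into consecutive entries
-- of row `n`. Hence `B n (pred w)` counts the strings of length `suc n` that are lighter than `w`
-- and have the parity of `w`.
Φ : ∀ {n} → Bits (suc n) → ℕ
Φ {n} x = suc (B n (pred (weight x)) + G x)

complement : ∀ {n} → Bits n → Bits n
complement = Vec.map not

weight-complement : ∀ {n} (x : Bits n) → weight (complement x) + weight x ≡ n
weight-complement []          = refl
weight-complement (true  ∷ x) = trans (+-suc _ _) (cong suc (weight-complement x))
weight-complement (false ∷ x) = cong suc (weight-complement x)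

-- Complementation reverses the lexicographic order, so `G (complement x)` counts the strings of the
-- weight of `x` that are smaller than `x`. With the larger ones and `x` itself they exhaust that
-- weight.
G-complement : ∀ {n} (x : Bits n) → suc (G x + G (complement x)) ≡ n C weight x
G-complement [] = refl
G-complement {suc n} (true ∷ x) = begin
  suc (G x + (G (complement x) + C⁻ n (weight (complement x)))) ≡⟨ cong suc (+-assoc (G x) _ _) ⟨
  suc (G x + G (complement x)) + C⁻ n (weight (complement x))   ≡⟨ cong₂ _+_ (G-complement x)
                                                                    (C⁻-sym (weight (complement x)) (weight x) (weight-complement x)) ⟩
  n C weight x + n C suc (weight x)                             ≡⟨ pascal n (weight x) ⟨
  suc n C suc (weight x)                                        ∎
  where open ≡-Reasoning
G-complement {suc n} (false ∷ x) = begin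
  suc (G x + C⁻ n (weight x) + G (complement x)) ≡⟨ rearrange (G x) (C⁻ n (weight x)) (G (complement x)) ⟩
  C⁻ n (weight x) + suc (G x + G (complement x)) ≡⟨ cong (C⁻ n (weight x) +_) (G-complement x) ⟩
  C⁻ n (weight x) + n C weight x                 ≡⟨ pascal⁻ n (weight x) ⟨
  suc n C weight x                               ∎
  where
  open ≡-Reasoning
  rearrange : ∀ a b c → suc (a + b + c) ≡ b + suc (a + c)
  rearrange = solve-∀

-- For `a = 0` the predecessor is truncated, and the other sum runs one entry past the end of the
-- row; that entry is 0.
B-pred-sym : ∀ n a b → a + b ≡ suc n → B n (pred a) + B n (suc b) ≡ 2 ^ n
B-pred-sym n zero    b refl = trans (cong₂ _+_ (B-full n) (k>n⇒nCk≡0 (n<1+n n))) (+-identityʳ (2 ^ n))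
B-pred-sym n (suc a) b eq   = B-sym n a (suc b) (trans (+-suc a b) eq)

-- Read through complementation, `Φ (complement x)` is one plus the number of strings in the parity
-- class of `x` that are heavier than `x`, or equally heavy and smaller. Together with those counted
-- by `Φ x` they are the `2 ^ n - 1` other members of the class.
Φ-complement : ∀ {n} (x : Bits (suc n)) → Φ x + Φ (complement x) ≡ suc (2 ^ n)
Φ-complement {n} x = begin
  Φ x + Φ (complement x)
    ≡⟨ rearrange (B n (pred w)) (G x) (B n (pred w′)) (G (complement x)) ⟩
  suc (B n (pred w′) + (B n (pred w) + suc (G x + G (complement x))))
    ≡⟨ cong (λ t → suc (B n (pred w′) + (B n (pred w) + t))) (trans (G-complement x) (pascal⁻ n w)) ⟩
  suc (B n (pred w′) + (B n (pred w) + (C⁻ n w + n C w)))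
    ≡⟨ cong (λ t → suc (B n (pred w′) + t)) (trans (sym (+-assoc (B n (pred w)) _ _)) (cong (_+ n C w) (B-pred n w))) ⟩
  suc (B n (pred w′) + B n (suc w))
    ≡⟨ cong suc (B-pred-sym n w′ w (weight-complement x)) ⟩
  suc (2 ^ n) ∎
  where
  open ≡-Reasoning
  w w′ : ℕ
  w  = weight x
  w′ = weight (complement x)
  rearrange : ∀ a b c d → suc (a + b) + suc (c + d) ≡ suc (c + (a + suc (b + d)))
  rearrange = solve-∀

-- The increment of `Φ` under the prefix 10. Raising `w` by one adds `suc n C w + n C w`, the source
-- of the two binomial coefficients in the bound.
D : ℕ → ℕ → ℕ
D n w = B (suc n) w + B n w

-- The leading 1 raises the weight by one, and the following 0 adds to `G` the strings that begin
-- with 11, `C⁻ (suc n) w` in number. Applying Pascal's rule twice isolates the term `B n (pred w)`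
-- of `Φ z`.
Φ-10 : ∀ {n} (z : Bits (suc n)) → Φ (true ∷ false ∷ z) ≡ Φ z + D n (weight z)
Φ-10 {n} z = cong suc (begin
  B (suc (suc n)) w + (G z + C⁻ (suc n) w)            ≡⟨ cong (_+ (G z + C⁻ (suc n) w)) (B-pascal⁻ (suc n) w) ⟩
  B (suc n) w + B (suc n) (pred w) + (G z + C⁻ (suc n) w) ≡⟨ rearrange₁ (B (suc n) w) (B (suc n) (pred w)) (G z) (C⁻ (suc n) w) ⟩
  B (suc n) w + (B (suc n) (pred w) + C⁻ (suc n) w) + G z ≡⟨ cong (λ t → B (suc n) w + t + G z) (trans (B-pred (suc n) w) (B-pascal⁻ n w)) ⟩
  B (suc n) w + (B n w + B n (pred w)) + G z          ≡⟨ rearrange₂ (B (suc n) w) (B n w) (B n (pred w)) (G z) ⟩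
  B n (pred w) + G z + (B (suc n) w + B n w)          ∎)
  where
  open ≡-Reasoning
  w : ℕ
  w = weight z
  rearrange₁ : ∀ a b c d → a + b + (c + d) ≡ a + (b + d) + c
  rearrange₁ = solve-∀
  rearrange₂ : ∀ a b c d → a + (b + c) + d ≡ c + d + (a + b)
  rearrange₂ = solve-∀

-- Positions in the sequence

filter-map : ∀ {A A′ : Set} {P : A′ → Set} (P? : Decidable P) (g : A → A′) xs →
             filter P? (map g xs) ≡ map g (filter (λ x → P? (g x)) xs)
filter-map P? g []       = refl
filter-map P? g (x ∷ xs) with ih ← filter-map P? g xs | P? (g x)
... | yes _ = cong (g x ∷_) ih
... | no  _ = ih

S-zero : ∀ n → S (suc n) 0 ≡ map (false ∷_) (S n 0)
S-zero n = begin
  S (suc n) 0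
    ≡⟨ filter-++ (λ x → weight x ≟ 0) (map (false ∷_) (allBits n)) _ ⟩
  filter (λ x → weight x ≟ 0) (map (false ∷_) (allBits n)) ++ filter (λ x → weight x ≟ 0) (map (true ∷_) (allBits n))
    ≡⟨ cong₂ _++_ (filter-map _ (false ∷_) (allBits n)) (trans (filter-map _ (true ∷_) (allBits n))
         (cong (map (true ∷_)) (filter-none (λ x → suc (weight x) ≟ 0) (All.universal (λ _ ()) (allBits n))))) ⟩
  map (false ∷_) (S n 0) ++ []
    ≡⟨ ++-identityʳ _ ⟩
  map (false ∷_) (S n 0) ∎
  where open ≡-Reasoning

S-suc : ∀ n i → S (suc n) (suc i) ≡ map (false ∷_) (S n (suc i)) ++ map (true ∷_) (S n i)
S-suc n i = trans
  (filter-++ (λ x → weight x ≟ suc i) (map (false ∷_) (allBits n)) _)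
  (cong₂ _++_ (filter-map _ (false ∷_) (allBits n)) (trans (filter-map _ (true ∷_) (allBits n))
    (cong (map (true ∷_)) (filter-≐ (λ x → suc (weight x) ≟ suc i) (λ x → weight x ≟ i)
      (suc-injective , cong suc) (allBits n)))))

length-S : ∀ n i → length (S n i) ≡ n C i
length-S zero    zero    = refl
length-S zero    (suc i) = refl
length-S (suc n) zero    = trans (cong length (S-zero n)) (trans (length-map _ (S n 0)) (length-S n 0))
length-S (suc n) (suc i) = begin
  length (S (suc n) (suc i))                                                  ≡⟨ cong length (S-suc n i) ⟩
  length (map (false ∷_) (S n (suc i)) ++ map (true ∷_) (S n i))               ≡⟨ length-++ (map (false ∷_) (S n (suc i))) ⟩
  length (map (false ∷_) (S n (suc i))) + length (map (true ∷_) (S n i))       ≡⟨ cong₂ _+_ (trans (length-map _ (S n (suc i))) (length-S n (suc i)))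
                                                                                            (trans (length-map _ (S n i)) (length-S n i)) ⟩
  n C suc i + n C i                                                           ≡⟨ +-comm (n C suc i) (n C i) ⟩
  n C i + n C suc i                                                           ≡⟨ pascal n i ⟨
  suc n C suc i                                                               ∎
  where open ≡-Reasoning

length-R : ∀ n i → length (R n i) ≡ n C i
length-R n i = trans (length-reverse (S n i)) (length-S n i)

-- In each block the strings beginning with 0 precede those beginning with 1. So behind a string
-- that begins with 0 stands the whole second half, which is the summand `C⁻` of `G`; for weight 0
-- that half is empty.
S-split : ∀ {n} (x : Bits n) → ∃ λ as → ∃ λ bs → S n (weight x) ≡ as ++ x ∷ bs × length bs ≡ G x
S-split [] = [] , [] , refl , refl
S-split {suc n} (true ∷ x) with as , bs , eq , len ← S-split x =
  map (false ∷_) (S n (suc (weight x))) ++ map (true ∷_) as , map (true ∷_) bs ,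
  (begin
    S (suc n) (suc (weight x))
      ≡⟨ S-suc n (weight x) ⟩
    front ++ map (true ∷_) (S n (weight x))
      ≡⟨ cong (λ l → front ++ map (true ∷_) l) eq ⟩
    front ++ map (true ∷_) (as ++ x ∷ bs)
      ≡⟨ cong (front ++_) (map-++ (true ∷_) as (x ∷ bs)) ⟩
    front ++ (map (true ∷_) as ++ (true ∷ x) ∷ map (true ∷_) bs)
      ≡⟨ ++-assoc front (map (true ∷_) as) _ ⟨
    (front ++ map (true ∷_) as) ++ (true ∷ x) ∷ map (true ∷_) bs ∎) ,
  trans (length-map _ bs) len
  where
  open ≡-Reasoning
  front : List (Bits (suc n))
  front = map (false ∷_) (S n (suc (weight x)))
S-split {suc n} (false ∷ x) with weight x | S-split x
... | zero  | as , bs , eq , len =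
  map (false ∷_) as , map (false ∷_) bs ,
  trans (S-zero n) (trans (cong (map (false ∷_)) eq) (map-++ (false ∷_) as (x ∷ bs))) ,
  trans (length-map _ bs) (trans len (sym (+-identityʳ (G x))))
... | suc i | as , bs , eq , len =
  map (false ∷_) as , map (false ∷_) bs ++ map (true ∷_) (S n i) ,
  trans (S-suc n i) (trans (cong (λ l → map (false ∷_) l ++ map (true ∷_) (S n i)) eq)
    (trans (cong (_++ map (true ∷_) (S n i)) (map-++ (false ∷_) as (x ∷ bs)))
           (++-assoc (map (false ∷_) as) ((false ∷ x) ∷ map (false ∷_) bs) _))) ,
  trans (length-++ (map (false ∷_) bs)) (cong₂ _+_ (trans (length-map _ bs) len)
    (trans (length-map _ (S n i)) (length-S n i)))

R-split : ∀ {n} (x : Bits n) → ∃ λ as → ∃ λ bs → R n (weight x) ≡ as ++ x ∷ bs × length as ≡ G x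
R-split x with as , bs , eq , len ← S-split x =
  reverse bs , reverse as ,
  trans (cong reverse eq) (trans (reverse-++ as (x ∷ bs))
    (trans (cong (_++ reverse as) (unfold-reverse x bs)) (++-assoc (reverse bs) [ x ] (reverse as)))) ,
  trans (length-reverse bs) len

upTo-split : ∀ w d → ∃ λ bs → upTo (suc (d + w)) ≡ upTo w ++ w ∷ bs
upTo-split w zero = [] , sym (upTo-∷ʳ w)
upTo-split w (suc d) with bs , eq ← upTo-split w d =
  bs ∷ʳ (suc d + w) ,
  trans (sym (upTo-∷ʳ (suc d + w))) (trans (cong (_∷ʳ (suc d + w)) eq) (++-assoc (upTo w) (w ∷ bs) _))

downFrom-split : ∀ w d → ∃ λ as → downFrom (suc (d + w)) ≡ as ++ w ∷ downFrom w
downFrom-split w zero = [] , refl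
downFrom-split w (suc d) with as , eq ← downFrom-split w d = suc d + w ∷ as , cong (suc d + w ∷_) eq

concatMap-filter-split : ∀ {A A′ : Set} {P : A → Set} (P? : Decidable P) (g : A → List A′) as {i} bs → P i →
  concatMap g (filter P? (as ++ i ∷ bs)) ≡ concatMap g (filter P? as) ++ g i ++ concatMap g (filter P? bs)
concatMap-filter-split P? g as {i} bs Pi = begin
  concatMap g (filter P? (as ++ i ∷ bs))                    ≡⟨ cong (concatMap g) (filter-++ P? as (i ∷ bs)) ⟩
  concatMap g (filter P? as ++ filter P? (i ∷ bs))          ≡⟨ concatMap-++ g (filter P? as) _ ⟩
  concatMap g (filter P? as) ++ concatMap g (filter P? (i ∷ bs)) ≡⟨ cong (λ l → concatMap g (filter P? as) ++ concatMap g l) (filter-accept P? Pi) ⟩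
  concatMap g (filter P? as) ++ g i ++ concatMap g (filter P? bs) ∎
  where open ≡-Reasoning

-- Parity and the total length of the lighter blocks

odd? : Decidable (λ i → ¬ (2 ∣ i))
odd? i = ¬? (2 ∣? i)

even⇒odd-suc : ∀ {i} → 2 ∣ i → ¬ (2 ∣ suc i)
even⇒odd-suc {i} 2∣i 2∣1+i with () ← ∣1⇒≡1 (∣m+n∣m⇒∣n (subst (2 ∣_) (+-comm 1 i) 2∣1+i) 2∣i)

odd⇒pred-even : ∀ w → ¬ (2 ∣ w) → ∃ λ q → w ≡ suc (q * 2)
odd⇒pred-even zero          odd = contradiction (divides 0 refl) odd
odd⇒pred-even (suc zero)    odd = 0 , refl
odd⇒pred-even (suc (suc w)) odd
  with q , eq ← odd⇒pred-even w (λ { (divides r refl) → odd (divides (suc r) refl) }) =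
  suc q , cong (suc ∘ suc) eq

odd-suc⇒even : ∀ {i} → ¬ (2 ∣ suc i) → 2 ∣ i
odd-suc⇒even odd with q , eq ← odd⇒pred-even _ odd = divides q (suc-injective eq)

odd⇒even-suc : ∀ {i} → ¬ (2 ∣ i) → 2 ∣ suc i
odd⇒even-suc odd with q , eq ← odd⇒pred-even _ odd = divides (suc q) (cong suc eq)

-- The block of weight `2i + 1` contributes the entries `2i` and `2i + 1` of row `n`, so the odd
-- blocks together cover each entry below `q * 2` once.
length-lighter-odd : ∀ n q → length (concatMap (R (suc n)) (filter odd? (upTo (suc (q * 2))))) ≡ B n (q * 2)
length-lighter-odd n zero    = refl
length-lighter-odd n (suc q) = begin
  length (concatMap (R (suc n)) (filter odd? (upTo (3 + r))))
    ≡⟨ cong (λ l → length (concatMap (R (suc n)) (filter odd? l))) upTo-3+r ⟩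
  length (concatMap (R (suc n)) (filter odd? (upTo (suc r) ++ suc r ∷ suc (suc r) ∷ [])))
    ≡⟨ cong length (concatMap-filter-split odd? (R (suc n)) (upTo (suc r)) (suc (suc r) ∷ []) (even⇒odd-suc (n∣m*n q))) ⟩
  length (lighter ++ R (suc n) (suc r) ++ concatMap (R (suc n)) (filter odd? (suc (suc r) ∷ [])))
    ≡⟨ cong (λ l → length (lighter ++ R (suc n) (suc r) ++ concatMap (R (suc n)) l))
         (filter-reject odd? (λ odd → odd (n∣m*n (suc q)))) ⟩
  length (lighter ++ R (suc n) (suc r) ++ [])
    ≡⟨ cong (λ l → length (lighter ++ l)) (++-identityʳ _) ⟩
  length (lighter ++ R (suc n) (suc r))
    ≡⟨ length-++ lighter ⟩
  length lighter + length (R (suc n) (suc r))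
    ≡⟨ cong₂ _+_ (length-lighter-odd n q) (trans (length-R (suc n) (suc r)) (pascal n r)) ⟩
  B n r + (n C r + n C suc r)
    ≡⟨ +-assoc (B n r) _ _ ⟨
  B n (suc (suc r)) ∎
  where
  open ≡-Reasoning
  r : ℕ
  r = q * 2
  lighter : List (Bits (suc n))
  lighter = concatMap (R (suc n)) (filter odd? (upTo (suc r)))
  upTo-3+r : upTo (3 + r) ≡ upTo (suc r) ++ suc r ∷ suc (suc r) ∷ []
  upTo-3+r = trans (sym (upTo-∷ʳ (2 + r))) (trans (cong (_∷ʳ (2 + r)) (sym (upTo-∷ʳ (suc r)))) (++-assoc (upTo (suc r)) _ _))

-- Here the block of weight `2i` contributes the entries `2i - 1` and `2i`, and the block of weight
-- 0 only the entry 0; hence the sum stops one entry earlier.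
length-lighter-even : ∀ n q → length (concatMap (S (suc n)) (filter (2 ∣?_) (downFrom (q * 2)))) ≡ B n (pred (q * 2))
length-lighter-even n zero    = refl
length-lighter-even n (suc q) = begin
  length (concatMap (S (suc n)) (filter (2 ∣?_) (suc r ∷ r ∷ downFrom r)))
    ≡⟨ cong (length ∘ concatMap (S (suc n))) (trans (filter-reject (2 ∣?_) (even⇒odd-suc (n∣m*n q))) (filter-accept (2 ∣?_) (n∣m*n q))) ⟩
  length (S (suc n) r ++ lighter)
    ≡⟨ length-++ (S (suc n) r) ⟩
  length (S (suc n) r) + length lighter
    ≡⟨ cong₂ _+_ (trans (length-S (suc n) r) (pascal⁻ n r)) (length-lighter-even n q) ⟩
  C⁻ n r + n C r + B n (pred r)
    ≡⟨ +-comm (C⁻ n r + n C r) _ ⟩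
  B n (pred r) + (C⁻ n r + n C r)
    ≡⟨ +-assoc (B n (pred r)) _ _ ⟨
  B n (pred r) + C⁻ n r + n C r
    ≡⟨ cong (_+ n C r) (B-pred n r) ⟩
  B n (suc r) ∎
  where
  open ≡-Reasoning
  r : ℕ
  r = q * 2
  lighter : List (Bits (suc n))
  lighter = concatMap (S (suc n)) (filter (2 ∣?_) (downFrom r))

-- Uniqueness fixes the position for every membership proof, so the one produced by `∈-seq` inside
-- `f` need not be inspected.
index-split : ∀ {A : Set} {x : A} {xs} as {bs} → xs ≡ as ++ x ∷ bs → Unique xs →
              (p : x ∈ xs) → toℕ (index p) ≡ length as
index-split []       refl _         (here _)    = refl
index-split []       refl (x∉ ∷ _)  (there p)   = contradiction refl (All.lookup x∉ p)
index-split (a ∷ as) refl (a∉ ∷ _)  (here refl) = contradiction refl (All.lookup a∉ (∈-++⁺ʳ as (here refl)))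
index-split (a ∷ as) refl (_ ∷ xs!) (there p)   = cong suc (index-split as refl xs! p)

f-split : ∀ n x as {bs} → seq n ≡ as ++ x ∷ bs → f n x ≡ suc (length as)
f-split n x as eq = cong suc (index-split as eq (seq-unique n) (∈-seq x))

weight≤ : ∀ {n} (x : Bits n) → ∃ λ d → n ≡ d + weight x
weight≤ x = weight (complement x) , sym (weight-complement x)

-- In front of `x` stand the lighter odd blocks and, as its own block is decreasing, the `G x`
-- larger strings of its weight.
f-odd : ∀ {n} (x : Bits (suc n)) → ¬ (2 ∣ weight x) → f (suc n) x ≡ Φ x
f-odd {n} x odd
  with d , n≡ ← weight≤ x
  with rest , up≡ ← upTo-split (weight x) d
  with as , bs , R≡ , len ← R-split x
  with q , w≡ ← odd⇒pred-even (weight x) odd =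
  trans (f-split (suc n) x (lighter ++ as) split)
    (cong suc (trans (length-++ lighter) (cong₂ _+_ lighter-length len)))
  where
  open ≡-Reasoning
  odds evens lighter heavier : List (Bits (suc n))
  odds    = concatMap (R (suc n)) (oddsUpTo (suc n))
  evens   = concatMap (S (suc n)) (evensDownFrom (suc n))
  lighter = concatMap (R (suc n)) (filter odd? (upTo (weight x)))
  heavier = concatMap (R (suc n)) (filter odd? rest)
  lighter-length : length lighter ≡ B n (pred (weight x))
  lighter-length = subst (λ w → length (concatMap (R (suc n)) (filter odd? (upTo w))) ≡ B n (pred w)) (sym w≡)
    (length-lighter-odd n q)
  split : seq (suc n) ≡ (lighter ++ as) ++ x ∷ ((bs ++ heavier) ++ evens)
  split = begin
    odds ++ evens
      ≡⟨ cong (λ l → concatMap (R (suc n)) (filter odd? l) ++ evens) (trans (cong (upTo ∘ suc) n≡) up≡) ⟩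
    concatMap (R (suc n)) (filter odd? (upTo (weight x) ++ weight x ∷ rest)) ++ evens
      ≡⟨ cong (_++ evens) (concatMap-filter-split odd? (R (suc n)) (upTo (weight x)) rest odd) ⟩
    (lighter ++ R (suc n) (weight x) ++ heavier) ++ evens
      ≡⟨ cong (λ l → (lighter ++ l ++ heavier) ++ evens) R≡ ⟩
    (lighter ++ (as ++ x ∷ bs) ++ heavier) ++ evens
      ≡⟨ cong (λ l → (lighter ++ l) ++ evens) (++-assoc as (x ∷ bs) heavier) ⟩
    (lighter ++ as ++ x ∷ (bs ++ heavier)) ++ evens
      ≡⟨ cong (_++ evens) (++-assoc lighter as _) ⟨
    ((lighter ++ as) ++ x ∷ (bs ++ heavier)) ++ evens
      ≡⟨ ++-assoc (lighter ++ as) _ evens ⟩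
    (lighter ++ as) ++ x ∷ ((bs ++ heavier) ++ evens) ∎

-- Even blocks come by decreasing weight and are themselves increasing, so the strings counted by
-- `Φ x` stand behind `x`. The `Φ x - 1` strings behind `x` and the `f (suc n) x` strings up to it
-- make up the whole sequence.
f-even : ∀ {n} (x : Bits (suc n)) → 2 ∣ weight x → f (suc n) x + Φ x ≡ suc (2 ^ suc n)
f-even {n} x even@(divides q w≡)
  with d , n≡ ← weight≤ x
  with rest , down≡ ← downFrom-split (weight x) d
  with as , bs , S≡ , len ← S-split x = begin
  f (suc n) x + Φ x
    ≡⟨ +-suc (f (suc n) x) _ ⟩
  suc (f (suc n) x + (B n (pred (weight x)) + G x))
    ≡⟨ cong₂ (λ s t → suc (s + t)) (f-split (suc n) x (odds ++ heavier ++ as) split)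
         (trans (+-comm _ (G x)) (cong₂ _+_ (sym len) (sym lighter-length))) ⟩
  suc (suc (length (odds ++ heavier ++ as)) + (length bs + length lighter))
    ≡⟨ cong suc (+-suc (length (odds ++ heavier ++ as)) _) ⟨
  suc (length (odds ++ heavier ++ as) + suc (length bs + length lighter))
    ≡⟨ cong (λ t → suc (length (odds ++ heavier ++ as) + suc t)) (length-++ bs) ⟨
  suc (length (odds ++ heavier ++ as) + length (x ∷ (bs ++ lighter)))
    ≡⟨ cong suc (length-++ (odds ++ heavier ++ as)) ⟨
  suc (length ((odds ++ heavier ++ as) ++ x ∷ (bs ++ lighter)))
    ≡⟨ cong (suc ∘ length) split ⟨
  suc (length (seq (suc n)))
    ≡⟨ cong suc (length-seq (suc n)) ⟩
  suc (2 ^ suc n) ∎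
  where
  open ≡-Reasoning
  odds evens lighter heavier : List (Bits (suc n))
  odds    = concatMap (R (suc n)) (oddsUpTo (suc n))
  evens   = concatMap (S (suc n)) (evensDownFrom (suc n))
  lighter = concatMap (S (suc n)) (filter (2 ∣?_) (downFrom (weight x)))
  heavier = concatMap (S (suc n)) (filter (2 ∣?_) rest)
  lighter-length : length lighter ≡ B n (pred (weight x))
  lighter-length = subst (λ w → length (concatMap (S (suc n)) (filter (2 ∣?_) (downFrom w))) ≡ B n (pred w)) (sym w≡)
    (length-lighter-even n q)
  split : seq (suc n) ≡ (odds ++ heavier ++ as) ++ x ∷ (bs ++ lighter)
  split = begin
    odds ++ evens
      ≡⟨ cong (λ l → odds ++ concatMap (S (suc n)) (filter (2 ∣?_) l)) (trans (cong (downFrom ∘ suc) n≡) down≡) ⟩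
    odds ++ concatMap (S (suc n)) (filter (2 ∣?_) (rest ++ weight x ∷ downFrom (weight x)))
      ≡⟨ cong (odds ++_) (concatMap-filter-split (2 ∣?_) (S (suc n)) rest (downFrom (weight x)) even) ⟩
    odds ++ heavier ++ S (suc n) (weight x) ++ lighter
      ≡⟨ cong (λ l → odds ++ heavier ++ l ++ lighter) S≡ ⟩
    odds ++ heavier ++ (as ++ x ∷ bs) ++ lighter
      ≡⟨ cong (λ l → odds ++ heavier ++ l) (++-assoc as (x ∷ bs) lighter) ⟩
    odds ++ heavier ++ as ++ x ∷ (bs ++ lighter)
      ≡⟨ cong (odds ++_) (++-assoc heavier as _) ⟨
    odds ++ (heavier ++ as) ++ x ∷ (bs ++ lighter)
      ≡⟨ ++-assoc odds (heavier ++ as) _ ⟨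
    (odds ++ heavier ++ as) ++ x ∷ (bs ++ lighter) ∎

-- Adjacency

Adjacent-sym : ∀ {n} {x y : Bits n} → Adjacent x y → Adjacent y x
Adjacent-sym (i , x≢y , i!) = i , x≢y ∘ sym , λ y≢x → i! (y≢x ∘ sym)

Adjacent-tail : ∀ {n} {b} {x y : Bits n} → Adjacent (b ∷ x) (b ∷ y) → Adjacent x y
Adjacent-tail (Fin.zero  , b≢b , _)  = contradiction refl b≢b
Adjacent-tail (Fin.suc i , x≢y , i!) = i , x≢y , λ x≢y′ → Fin.suc-injective (i! x≢y′)

Adjacent-complement : ∀ {n} {x y : Bits n} → Adjacent x y → Adjacent (complement x) (complement y)
Adjacent-complement {x = x} {y} (i , x≢y , i!) = i ,
  (λ eq → x≢y (Bool.not-injective (trans (sym (Vec.lookup-map i not x)) (trans eq (Vec.lookup-map i not y))))) ,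
  λ {j} x≢y′ → i! λ eq → x≢y′ (trans (Vec.lookup-map j not x) (trans (cong not eq) (sym (Vec.lookup-map j not y))))

lookup-ext : ∀ {n} {x y : Bits n} → (∀ i → Vec.lookup x i ≡ Vec.lookup y i) → x ≡ y
lookup-ext {x = []}    {[]}    _ = refl
lookup-ext {x = _ ∷ _} {_ ∷ _} h = cong₂ _∷_ (h Fin.zero) (lookup-ext (h ∘ Fin.suc))

Adjacent⇒weight : ∀ {n} {x y : Bits n} → Adjacent x y →
                  weight x ≡ suc (weight y) ⊎ weight y ≡ suc (weight x)
Adjacent⇒weight {x = a ∷ x} {b ∷ y} (Fin.zero , a≢b , i!)
  -- Uniqueness of the differing position forces the tails to agree, so only the first bits affect
  -- the weights.
  with refl ← lookup-ext {x = x} {y} (λ j → decidable-stable (Vec.lookup x j Bool.≟ Vec.lookup y j)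
                (λ x≢y → contradiction (i! {Fin.suc j} x≢y) λ ()))
  with a | b
... | true  | true  = contradiction refl a≢b
... | true  | false = inj₁ refl
... | false | true  = inj₂ refl
... | false | false = contradiction refl a≢b
Adjacent⇒weight {x = true  ∷ x} {true  ∷ y} xy@(Fin.suc _ , _) =
  Sum.map (cong suc) (cong suc) (Adjacent⇒weight {x = x} {y} (Adjacent-tail {x = x} {y} xy))
Adjacent⇒weight {x = false ∷ x} {false ∷ y} xy@(Fin.suc _ , _) = Adjacent⇒weight {x = x} {y} (Adjacent-tail {x = x} {y} xy)
Adjacent⇒weight {x = true  ∷ _} {false ∷ _} (Fin.suc _ , _ , i!) = contradiction (i! {Fin.zero} λ ()) λ ()
Adjacent⇒weight {x = false ∷ _} {true  ∷ _} (Fin.suc _ , _ , i!) = contradiction (i! {Fin.zero} λ ()) λ ()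

-- Complementation in an even-dimensional cube and the effect of the prefix 10

even-complement : ∀ {n} → 2 ∣ n → (x : Bits n) → 2 ∣ weight x → 2 ∣ weight (complement x)
even-complement 2∣n x = ∣m+n∣m⇒∣n
  (subst (2 ∣_) (trans (sym (weight-complement x)) (+-comm (weight (complement x)) _)) 2∣n)

odd-complement : ∀ {n} → 2 ∣ n → (x : Bits n) → ¬ (2 ∣ weight x) → ¬ (2 ∣ weight (complement x))
odd-complement 2∣n x odd even = odd (∣m+n∣m⇒∣n (subst (2 ∣_) (sym (weight-complement x)) 2∣n) even)

-- The small cube has dimension `suc n` and the large one `3 + n`. The prefix 10 exchanges parities:
-- 10u has odd weight and 10v even weight, whereas complementation in the small cube keeps both
-- parities.
module _ {n} (2∣1+n : 2 ∣ suc n) (u v : Bits (suc n)) (2∣u : 2 ∣ weight u) (2∤v : ¬ (2 ∣ weight v)) where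

  f-complement-even : f (suc n) (complement u) ≡ Φ u + 2 ^ n
  f-complement-even = +-cancelʳ-≡ (Φ (complement u)) _ _ (begin
    f (suc n) (complement u) + Φ (complement u) ≡⟨ f-even (complement u) (even-complement 2∣1+n u 2∣u) ⟩
    suc (2 ^ suc n)                             ≡⟨ rearrange₁ (2 ^ n) ⟩
    suc (2 ^ n) + 2 ^ n                         ≡⟨ cong (_+ 2 ^ n) (Φ-complement u) ⟨
    Φ u + Φ (complement u) + 2 ^ n              ≡⟨ rearrange₂ (Φ u) (Φ (complement u)) (2 ^ n) ⟩
    Φ u + 2 ^ n + Φ (complement u)              ∎)
    where
    open ≡-Reasoning
    rearrange₁ : ∀ p → suc (2 * p) ≡ suc p + p
    rearrange₁ = solve-∀
    rearrange₂ : ∀ a b c → a + b + c ≡ a + c + b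
    rearrange₂ = solve-∀

  f-complement-odd : Φ v + f (suc n) (complement v) ≡ suc (2 ^ n)
  f-complement-odd = trans (cong (Φ v +_) (f-odd (complement v) (odd-complement 2∣1+n v 2∤v))) (Φ-complement v)

  -- The term `D n (weight v)` enters negatively through the even string 10v, so it is moved to the
  -- left to avoid subtraction. The constant is the total `8 * 2 ^ n` from the large cube less the
  -- `2 * 2 ^ n` already contained in the two complementary values.
  f-10-balance : f (3 + n) (true ∷ false ∷ u) + f (3 + n) (true ∷ false ∷ v) + D n (weight v) ≡
                 f (suc n) (complement u) + f (suc n) (complement v) + 3 * 2 ^ suc n + D n (weight u)
  f-10-balance = +-cancelʳ-≡ (Φ v) _ _ (begin
    fu + fv + dv + Φ v                          ≡⟨ rearrange₁ fu fv dv (Φ v) ⟩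
    fu + (fv + (Φ v + dv))                      ≡⟨ cong₂ _+_ (trans (f-odd (true ∷ false ∷ u) (even⇒odd-suc 2∣u)) (Φ-10 u))
                                                     (trans (cong (fv +_) (sym (Φ-10 v))) (f-even (true ∷ false ∷ v) (odd⇒even-suc 2∤v))) ⟩
    Φ u + du + suc (2 ^ (3 + n))                ≡⟨ rearrange₂ (Φ u) du (2 ^ n) ⟩
    Φ u + 2 ^ n + suc (2 ^ n) + 3 * 2 ^ suc n + du
                                                ≡⟨ cong₂ (λ s t → s + t + 3 * 2 ^ suc n + du) f-complement-even f-complement-odd ⟨
    f (suc n) (complement u) + (Φ v + f (suc n) (complement v)) + 3 * 2 ^ suc n + du
                                                ≡⟨ rearrange₃ (f (suc n) (complement u)) (Φ v) (f (suc n) (complement v)) (3 * 2 ^ suc n) du ⟩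
    f (suc n) (complement u) + f (suc n) (complement v) + 3 * 2 ^ suc n + du + Φ v ∎)
    where
    open ≡-Reasoning
    fu fv du dv : ℕ
    fu = f (3 + n) (true ∷ false ∷ u)
    fv = f (3 + n) (true ∷ false ∷ v)
    du = D n (weight u)
    dv = D n (weight v)
    rearrange₁ : ∀ a b c d → a + b + c + d ≡ a + (b + (d + c))
    rearrange₁ = solve-∀
    rearrange₂ : ∀ a b p → a + b + suc (2 * (2 * (2 * p))) ≡ a + p + suc p + 3 * (2 * p) + b
    rearrange₂ = solve-∀
    rearrange₃ : ∀ a b c d e → a + (b + c) + d + e ≡ a + c + d + e + b
    rearrange₃ = solve-∀

  f-10-bound : Adjacent u v →
    f (3 + n) (true ∷ false ∷ u) + f (3 + n) (true ∷ false ∷ v) ≤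
    str (suc n) (f (suc n)) + 3 * 2 ^ suc n + n C ⌈ n /2⌉ + suc n C ⌈ suc n /2⌉
  f-10-bound uv = +-cancelʳ-≤ (D n k) _ _ (begin
    f (3 + n) (true ∷ false ∷ u) + f (3 + n) (true ∷ false ∷ v) + D n k
      ≡⟨ f-10-balance ⟩
    f (suc n) (complement u) + f (suc n) (complement v) + 3 * 2 ^ suc n + D n (weight u)
      ≤⟨ +-mono-≤ (+-monoˡ-≤ (3 * 2 ^ suc n) (str-upper (f (suc n)) {complement u} {complement v} (Adjacent-complement {x = u} {v} uv)))
           -- `D` is monotone and `weight u` is at most `suc k`, so `D n (weight u)` exceeds `D n k`
           -- by at most `suc n C k + n C k`; each of these is bounded by the central entry of its
           -- row.
           (≤-trans (+-mono-≤ (B-mono (suc n) u≤1+k) (B-mono n u≤1+k))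
             (+-mono-≤ (+-monoʳ-≤ (B (suc n) k) (C≤central (suc n) k)) (+-monoʳ-≤ (B n k) (C≤central n k)))) ⟩
    str (suc n) (f (suc n)) + 3 * 2 ^ suc n + (B (suc n) k + suc n C ⌈ suc n /2⌉ + (B n k + n C ⌈ n /2⌉))
      ≡⟨ rearrange (str (suc n) (f (suc n)) + 3 * 2 ^ suc n) (B (suc n) k) (suc n C ⌈ suc n /2⌉) (B n k) (n C ⌈ n /2⌉) ⟩
    str (suc n) (f (suc n)) + 3 * 2 ^ suc n + n C ⌈ n /2⌉ + suc n C ⌈ suc n /2⌉ + D n k ∎)
    where
    open ≤-Reasoning
    k : ℕ
    k = weight v
    u≤1+k : weight u ≤ suc k
    u≤1+k with Adjacent⇒weight {x = u} {v} uv
    ... | inj₁ eq = ≤-reflexive eq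
    ... | inj₂ eq = m≤n⇒m≤1+n (subst (weight u ≤_) (sym eq) (n≤1+n (weight u)))
    rearrange : ∀ s a b c d → s + (a + b + (c + d)) ≡ s + d + b + (a + c)
    rearrange = solve-∀

Adjacent-even⇒odd : ∀ {n} {x y : Bits n} → Adjacent x y → 2 ∣ weight x → ¬ (2 ∣ weight y)
Adjacent-even⇒odd {x = x} {y} xy 2∣x 2∣y with Adjacent⇒weight {x = x} {y} xy
... | inj₁ eq = even⇒odd-suc 2∣y (subst (2 ∣_) eq 2∣x)
... | inj₂ eq = even⇒odd-suc 2∣x (subst (2 ∣_) eq 2∣y)

Adjacent-odd⇒even : ∀ {n} {x y : Bits n} → Adjacent x y → ¬ (2 ∣ weight x) → 2 ∣ weight y
Adjacent-odd⇒even {x = x} {y} xy 2∤x with Adjacent⇒weight {x = x} {y} xy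
... | inj₁ eq = odd-suc⇒even (subst (λ w → ¬ (2 ∣ w)) eq 2∤x)
... | inj₂ eq = subst (2 ∣_) (sym eq) (odd⇒even-suc 2∤x)

theorem2p8 : (n : ℕ) → n ≥ 5 → 2 ∣ n →
    (x y : Bits n) → Adjacent x y →
    f n x + f n y ≡ str n (f n) →
    Prefix _≡_ (true ∷ false ∷ []) (toList x) →
    Prefix _≡_ (true ∷ false ∷ []) (toList y) →
    str n (f n) ≤ str (n ∸ 2) (f (n ∸ 2)) + 3 * 2 ^ (n ∸ 2) + ((n ∸ 3) C ⌈ n ∸ 3 /2⌉) + ((n ∸ 2) C ⌈ n ∸ 2 /2⌉)
theorem2p8 (suc (suc (suc n))) (s≤s (s≤s (s≤s _))) 2∣n (_ ∷ _ ∷ u) (_ ∷ _ ∷ v) xy attained (refl ∷ refl ∷ _) (refl ∷ refl ∷ _) =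
  -- The given edge attains the maximum, so bounding its sum bounds `str`.
  ≤-trans (≤-reflexive (sym attained)) bound
  where
  2∣1+n : 2 ∣ suc n
  2∣1+n = ∣m+n∣m⇒∣n {m = 2} 2∣n (divides 1 refl)
  uv : Adjacent u v
  uv = Adjacent-tail {x = u} {v} (Adjacent-tail {x = false ∷ u} {false ∷ v} xy)
  bound : f (3 + n) (true ∷ false ∷ u) + f (3 + n) (true ∷ false ∷ v) ≤
          str (suc n) (f (suc n)) + 3 * 2 ^ suc n + n C ⌈ n /2⌉ + suc n C ⌈ suc n /2⌉
  -- Exactly one end of the edge has even weight; `f-10-bound` takes that end first, so the edge is
  -- reversed when `u` has odd weight.
  bound with 2 ∣? weight u
  ... | yes 2∣u = f-10-bound 2∣1+n u v 2∣u (Adjacent-even⇒odd {x = u} {v} uv 2∣u) uv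
  ... | no 2∤u  = ≤-trans (≤-reflexive (+-comm (f (3 + n) (true ∷ false ∷ u)) _))
    (f-10-bound 2∣1+n v u (Adjacent-odd⇒even {x = u} {v} uv 2∤u) 2∤u (Adjacent-sym {x = u} {v} uv))
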